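{- Let $\mathcal{H}$ be a hypergraph on a finite vertex set $V$ that is circular-arc, twin-free, and strictly overlap-connected. Then $\mathcal{H}$ has, up to reversal, a unique arc ordering.
   Context: A hypergraph $\mathcal{H}$ consists of a finite vertex set $V=V(\mathcal{H})$ and a family of subsets of $V$ called hyperedges; $\mathcal{H}$ also denotes its set of hyperedges. A circular ordering of $V=\{v_1,\dots,v_n\}$ is given by a circular successor relation ($v_i$ is followed by $v_{i+1}$, and $v_n$ by $v_1$); an arc is a set of consecutive vertices in this circular order (the empty set and $V$ itself are also arcs). An arc ordering of $\mathcal{H}$ is a circular ordering of $V$ in which every hyperedge is an arc; $\mathcal{H}$ is circular-arc (CA) if it admits an arc ordering. Uniqueness "up to reversal" means any two arc orderings are equal or reverses of each other. Two distinct vertices are twins if every hyperedge contains both or neither of them; $\mathcal{H}$ is twin-free if it has no twins. Two sets $A,B\subseteq V$ overlap if $A\cap B\neq\emptyset$, $A\not\subseteq B$ and $B\not\subseteq A$; they strictly overlap if they overlap and $A\cup B\neq V$. $\mathcal{H}$ is strictly overlap-connected if every vertex lies in some hyperedge and the graph on the set of hyperedges in which two hyperedges are adjacent iff they strictly overlap is connected. -}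

module Defs where

open import Data.Nat as ℕ using (ℕ; zero; suc; _≤_; _<_; s≤s)
open import Data.Fin using (Fin; toℕ; fromℕ<)
open import Data.Fin.Subset using (Subset; _∈_; _∉_; _⊆_)
open import Data.Fin.Permutation using (Permutation′; _⟨$⟩ʳ_; _⟨$⟩ˡ_)
open import Data.List using (List)
import Data.List.Membership.Propositional as L
open import Data.Product using (Σ; ∃; ∃-syntax; _×_)
open import Data.Sum using (_⊎_)
open import Function using (_⇔_)
open import Relation.Nullary using (¬_; yes; no)
open import Relation.Binary.PropositionalEquality using (_≡_)
open import Relation.Binary.Construct.Closure.ReflexiveTransitive using (Star)

Hypergraph : ℕ → Set
Hypergraph n = List (Subset n)

next : ∀ {n} → Fin n → Fin n
next {suc n} i with toℕ i ℕ.<? n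
... | yes p = fromℕ< (s≤s p)
... | no  _ = Fin.zero

-- A circular ordering of V is given by a bijection  pos : V → positions  (Fin n);
-- it induces the circular successor relation below.
CircularOrdering : ℕ → Set
CircularOrdering n = Permutation′ n

succV : ∀ {n} → CircularOrdering n → Fin n → Fin n
succV π v = π ⟨$⟩ˡ next (π ⟨$⟩ʳ v)

iterate : ∀ {A : Set} → (A → A) → ℕ → A → A
iterate f zero    x = x
iterate f (suc k) x = f (iterate f k x)

IsArc : ∀ {n} → CircularOrdering n → Subset n → Set
IsArc {n} π A =
  (∀ u → u ∉ A) ⊎
  (∃[ v ] ∃[ k ] (k ≤ n × (∀ u → (u ∈ A) ⇔ (∃[ i ] (i < k × u ≡ iterate (succV π) i v)))))

IsArcOrdering : ∀ {n} → Hypergraph n → CircularOrdering n → Set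
IsArcOrdering H π = ∀ E → E L.∈ H → IsArc π E

CircularArc : ∀ {n} → Hypergraph n → Set
CircularArc H = ∃[ π ] IsArcOrdering H π

SameOrdering : ∀ {n} → CircularOrdering n → CircularOrdering n → Set
SameOrdering π ρ = ∀ v → succV π v ≡ succV ρ v

ReverseOrdering : ∀ {n} → CircularOrdering n → CircularOrdering n → Set
ReverseOrdering π ρ = ∀ v → succV ρ (succV π v) ≡ v

Twins : ∀ {n} → Hypergraph n → Fin n → Fin n → Set
Twins H u v = ¬ (u ≡ v) × (∀ E → E L.∈ H → (u ∈ E) ⇔ (v ∈ E))

TwinFree : ∀ {n} → Hypergraph n → Set
TwinFree H = ∀ u v → ¬ Twins H u v

Overlap : ∀ {n} → Subset n → Subset n → Set
Overlap A B = (∃[ x ] (x ∈ A × x ∈ B)) × ¬ (A ⊆ B) × ¬ (B ⊆ A)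

StrictOverlap : ∀ {n} → Subset n → Subset n → Set
StrictOverlap A B = Overlap A B × (∃[ x ] (x ∉ A × x ∉ B))

SOEdge : ∀ {n} → Hypergraph n → Subset n → Subset n → Set
SOEdge H A B = A L.∈ H × B L.∈ H × StrictOverlap A B

StrictlyOverlapConnected : ∀ {n} → Hypergraph n → Set
StrictlyOverlapConnected {n} H =
  (∀ (v : Fin n) → ∃[ E ] (E L.∈ H × v ∈ E)) ×
  (∀ A B → A L.∈ H → B L.∈ H → Star (SOEdge H) A B)

{-# OPTIONS --safe #-}
module Submission where

-- Fix a vertex x and replace every hyperedge containing x by its complement. An arc
-- ordering read from x becomes a linear order in which all these sets are convex, and
-- strictly overlapping hyperedges become overlapping sets avoiding x. For overlapping A and
-- B, a convex order puts A to the left of B or conversely. If A, B and B, C overlap,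
-- then A and C extend B to the same side iff A ∩ C ⊈ B, so along the connected overlap graph
-- one orientation determines all others and two orders agree on all overlaps after possibly
-- reversing one. A vertex v outside a set E lies on the side of E given by the first set
-- containing v on a path of overlaps leaving E, so the orders agree on all pairs separated
-- by some set, which by twin-freeness are all pairs of vertices other than x.

open import Defs
open import Data.Empty using (⊥-elim)
open import Data.Fin using (Fin; toℕ)
open import Data.Fin.Permutation using (_⟨$⟩ʳ_; inverseʳ)
open import Data.Fin.Properties using (_≟_; any?; toℕ<n; toℕ-fromℕ<; toℕ-injective; toℕ≤pred[n])
open import Data.Fin.Subset using (Subset; _∈_; _∉_)
open import Data.Fin.Subset.Properties using (_∈?_)
import Data.List.Membership.Propositional as L
import Data.List.Relation.Unary.Any as Any
open import Data.Nat using (ℕ; zero; suc; _+_; _∸_; _≤_; _<_; z≤n; s≤s; z<s; NonZero; _<?_)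
open import Data.Nat.DivMod using (_%_; m<n⇒m%n≡m; n%n≡0; m%n<n; m%n%n≡m%n; %-distribˡ-+; [m+n]%n≡m%n)
open import Data.Nat.Properties hiding (_≟_)
open import Data.Product using (∃-syntax; _×_; _,_)
open import Data.Sum using (_⊎_; inj₁; inj₂)
open import Function using (flip; _∘_; _on_; _⇔_; mk⇔; Equivalence; Injection)
open import Function.Properties.Inverse using (↔⇒↣)
open import Level using (0ℓ)
open import Relation.Nullary using (¬_; yes; no)
open import Relation.Nullary.Decidable using (_×-dec_; _⊎-dec_; ¬?; decidable-stable)
open import Relation.Unary using (Decidable)
open import Relation.Binary using (Rel; IsStrictTotalOrder; tri<; tri≈; tri>)
open import Relation.Binary.PropositionalEquality
open import Relation.Binary.Construct.Closure.ReflexiveTransitive as Star using (Star; ε; _◅_)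
import Relation.Binary.Construct.Flip.EqAndOrd as Flip

-- Families of sets convex in a linear order.

module ConvexFamily {V I : Set} (Edge : I → Set) (_∋_ : I → V → Set)
                    (_∋?_ : ∀ E → Decidable (E ∋_)) where

  Overlapping : I → I → Set
  Overlapping A B = Edge A × Edge B ×
    (∃[ p ] (A ∋ p × B ∋ p)) ×
    (∃[ q ] (A ∋ q × ¬ B ∋ q)) ×
    (∃[ r ] (B ∋ r × ¬ A ∋ r))

  record Compatible (_≺_ : Rel V 0ℓ) : Set where
    field
      isStrictTotalOrder : IsStrictTotalOrder _≡_ _≺_
      convex : ∀ {E a b c} → Edge E → E ∋ a → E ∋ c → a ≺ b → b ≺ c → E ∋ b

    open IsStrictTotalOrder isStrictTotalOrder public using (trans; asym; compare)

  reverse : ∀ {_≺_} → Compatible _≺_ → Compatible (flip _≺_)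
  reverse C = record
    { isStrictTotalOrder = Flip.isStrictTotalOrder isStrictTotalOrder
    ; convex = λ e a c a≺b b≺c → convex e c a b≺c a≺b }
    where open Compatible C

  -- For overlapping sets this is the block order `A` minus `B`, then `A ∩ B`, then `B` minus `A`,
  -- with no demand inside a block. Reversing the order exchanges the two clauses.
  Before : Rel V 0ℓ → I → I → Set
  Before _≺_ A B = (∀ {a b} → A ∋ a → ¬ B ∋ a → B ∋ b → a ≺ b)
                 × (∀ {a b} → A ∋ a → B ∋ b → ¬ A ∋ b → a ≺ b)

  before-reverse : ∀ {_≺_ A B} → Before _≺_ A B → Before (flip _≺_) B A
  before-reverse (f , g) = (λ b ¬a a → g a b ¬a) , (λ b a ¬b → f a ¬b b)

  -- A point outside a convex set cannot lie between two of its members, so its comparison with one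
  -- member settles all the others.
  before-all : ∀ {_≺_ E v a b} → Compatible _≺_ → Edge E → ¬ E ∋ v →
               E ∋ a → E ∋ b → v ≺ a → v ≺ b
  before-all {v = v} {b = b} C e v∉ a∈ b∈ v≺a with Compatible.compare C v b
  ... | tri< v≺b _ _ = v≺b
  ... | tri≈ _ refl _ = ⊥-elim (v∉ b∈)
  ... | tri> _ _ b≺v = ⊥-elim (v∉ (Compatible.convex C e b∈ a∈ b≺v v≺a))

  after-all : ∀ {_≺_ E v a b} → Compatible _≺_ → Edge E → ¬ E ∋ v →
              E ∋ a → E ∋ b → a ≺ v → b ≺ v
  after-all C = before-all (reverse C)

  -- One comparison spreads by `before-all`: from `q ≺ p` the point `q` precedes all of `B`, in
  -- particular `r`; since `r` is outside `A` and `q` inside, all of `A` precedes `r`. These two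
  -- facts yield the two clauses.
  before-from-witness : ∀ {_≺_ A B p q} → Compatible _≺_ → Overlapping A B →
    A ∋ p → B ∋ p → A ∋ q → ¬ B ∋ q → q ≺ p → Before _≺_ A B
  before-from-witness {_≺_} {A} {B} {p} {q} C (eA , eB , _ , _ , r , r∈B , r∉A) pA pB qA q∉B q≺p =
    (λ a∈A a∉B b∈B → before-all C eB a∉B r∈B b∈B (A≺r a∈A)) ,
    (λ a∈A b∈B b∉A → after-all C eA b∉A qA a∈A (q≺B b∈B))
    where
    q≺B : ∀ {b} → B ∋ b → q ≺ b
    q≺B b∈B = before-all C eB q∉B pB b∈B q≺p
    A≺r : ∀ {a} → A ∋ a → a ≺ r
    A≺r a∈A = after-all C eA r∉A qA a∈A (q≺B r∈B)

  orient : ∀ {_≺_ A B} → Compatible _≺_ → Overlapping A B → Before _≺_ A B ⊎ Before _≺_ B A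
  orient C o@(_ , _ , (p , pA , pB) , (q , qA , q∉B) , _) with Compatible.compare C q p
  ... | tri< q≺p _ _ = inj₁ (before-from-witness C o pA pB qA q∉B q≺p)
  ... | tri≈ _ refl _ = ⊥-elim (q∉B pB)
  ... | tri> _ _ p≺q =
    inj₂ (before-reverse (before-from-witness (reverse C) o pA pB qA q∉B p≺q))

  -- Two neighbours of B extend beyond B on the same side iff they share a vertex
  -- outside B, a condition that does not mention the order.
  same-side : ∀ {_≺_ A B C} → Compatible _≺_ → Overlapping A B → Overlapping B C →
    Before _≺_ A B → Before _≺_ C B → ∃[ z ] (A ∋ z × C ∋ z × ¬ B ∋ z)
  same-side K (eA , _ , (p , pA , pB) , (q , qA , q∉B) , _)
              (_ , eC , (p′ , p′B , p′C) , _ , (r , rC , r∉B)) (A<B , _) (C<B , _)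
    with Compatible.compare K q r
  ... | tri< q≺r _ _  = r , Compatible.convex K eA qA pA q≺r (C<B rC r∉B pB) , rC , r∉B
  ... | tri≈ _ refl _ = q , qA , rC , q∉B
  ... | tri> _ _ r≺q  = q , qA , Compatible.convex K eC rC p′C r≺q (A<B qA q∉B p′B) , q∉B

  -- A common point of `A` and `C` outside `B` would lie both before and after any point of `A ∩ B`.
  opposite-sides : ∀ {_≺_ A B C} → Compatible _≺_ → Overlapping A B →
    Before _≺_ A B → Before _≺_ B C → ¬ (∃[ z ] (A ∋ z × C ∋ z × ¬ B ∋ z))
  opposite-sides K (_ , _ , (_ , _ , pB) , _) (A<B , _) (_ , B<C) (z , zA , zC , z∉B) =
    Compatible.asym K (A<B zA z∉B pB) (B<C pB zC z∉B)

  -- Propagation of one orientation along the overlap graph.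

  module Rigidity
    (connected : ∀ A B → Edge A → Edge B → Star Overlapping A B)
    (separated : ∀ {u v} → (∃[ E ] (Edge E × E ∋ u)) → (∃[ E ] (Edge E × E ∋ v)) → u ≢ v →
                 ∃[ E ] (Edge E × ((E ∋ u × ¬ E ∋ v) ⊎ (E ∋ v × ¬ E ∋ u))))
    where

    -- In the application these are exactly the vertices other than the base, which lies in no set
    -- once complements are taken.
    Covered : V → Set
    Covered v = ∃[ E ] (Edge E × E ∋ v)

    Coherent : Rel V 0ℓ → Rel V 0ℓ → I → I → Set
    Coherent _≺_ _⊏_ A B = (Before _≺_ A B × Before _⊏_ A B) ⊎ (Before _≺_ B A × Before _⊏_ B A)

    coherent-reverse : ∀ {_≺_ _⊏_ A B} → Coherent _≺_ _⊏_ A B → Coherent (flip _≺_) (flip _⊏_) A B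
    coherent-reverse (inj₁ (d , e)) = inj₂ (before-reverse d , before-reverse e)
    coherent-reverse (inj₂ (d , e)) = inj₁ (before-reverse d , before-reverse e)

    -- If the orders disagreed on `B` and `C`, one would put `A` and `C` on the same side of `B` and
    -- the other on opposite sides, so a common point outside `B` would both exist and not exist.
    before-step : ∀ {_≺_ _⊏_ A B C} → Compatible _≺_ → Compatible _⊏_ →
      Overlapping A B → Overlapping B C → Before _≺_ A B → Before _⊏_ A B → Coherent _≺_ _⊏_ B C
    before-step K L o o′ d e with orient K o′ | orient L o′
    ... | inj₁ d′ | inj₁ e′ = inj₁ (d′ , e′)
    ... | inj₂ d′ | inj₂ e′ = inj₂ (d′ , e′)
    ... | inj₁ d′ | inj₂ e′ = ⊥-elim (opposite-sides K o d d′ (same-side L o o′ e e′))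
    ... | inj₂ d′ | inj₁ e′ = ⊥-elim (opposite-sides L o e e′ (same-side K o o′ d d′))

    coherent-step : ∀ {_≺_ _⊏_ A B C} → Compatible _≺_ → Compatible _⊏_ →
      Overlapping A B → Overlapping B C → Coherent _≺_ _⊏_ A B → Coherent _≺_ _⊏_ B C
    coherent-step K L o o′ (inj₁ (d , e)) = before-step K L o o′ d e
    coherent-step K L o o′ (inj₂ (d , e)) = coherent-reverse
      (before-step (reverse K) (reverse L) o o′ (before-reverse d) (before-reverse e))

    coherent-path : ∀ {_≺_ _⊏_ A B C D} → Compatible _≺_ → Compatible _⊏_ →
      Overlapping A B → Coherent _≺_ _⊏_ A B → Star Overlapping B C →
      Overlapping C D → Coherent _≺_ _⊏_ C D
    coherent-path K L o c ε        o′ = coherent-step K L o o′ c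
    coherent-path K L o c (o″ ◅ s) o′ = coherent-path K L o″ (coherent-step K L o o″ c) s o′

    AllCoherent : Rel V 0ℓ → Rel V 0ℓ → Set
    AllCoherent _≺_ _⊏_ = ∀ {A B} → Overlapping A B → Coherent _≺_ _⊏_ A B

    coherent-everywhere : ∀ {_≺_ _⊏_ A B} → Compatible _≺_ → Compatible _⊏_ →
      Overlapping A B → Coherent _≺_ _⊏_ A B → AllCoherent _≺_ _⊏_
    coherent-everywhere K L o@(_ , eB , _) c o′@(eC , _) =
      coherent-path K L o c (connected _ _ eB eC) o′

    -- Induction on the path from `A` to a set containing `v`. When the next set `B` contains `v`,
    -- the common orientation of `A` and `B` decides on which side of `A` the point `v` lies.
    before-transfer : ∀ {_≺_ _⊏_ A F v a} → Compatible _≺_ → Compatible _⊏_ → AllCoherent _≺_ _⊏_ →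
      Star Overlapping A F → F ∋ v → ¬ A ∋ v → A ∋ a → v ≺ a → v ⊏ a
    before-transfer K L h ε v∈F v∉A a∈A v≺a = ⊥-elim (v∉A v∈F)
    before-transfer {v = v} K L h (_◅_ {j = B} o@(eA , _ , (_ , pA , pB) , _) s) v∈F v∉A a∈A v≺a
      with B ∋? v | h o
    ... | yes v∈B | inj₁ ((_ , A<B) , _) = ⊥-elim (Compatible.asym K v≺a (A<B a∈A v∈B v∉A))
    ... | yes v∈B | inj₂ (_ , B<A , _)   = B<A v∈B v∉A a∈A
    -- The comparison moves from `a` to a point of `A ∩ B`, passes to `⊏` by induction from `B`, and
    -- moves back to `a`.
    ... | no v∉B  | _ = before-all L eA v∉A pA a∈A
      (before-transfer K L h s v∈F v∉B pB (before-all K eA v∉A a∈A pA v≺a))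

    order-agrees : ∀ {_≺_ _⊏_} → Compatible _≺_ → Compatible _⊏_ → AllCoherent _≺_ _⊏_ →
      ∀ {u v} → Covered u → Covered v → u ≺ v → u ⊏ v
    order-agrees {_≺_} K L h {u} {v} cu@(F , eF , u∈F) cv@(G , eG , v∈G) u≺v
      with separated cu cv (λ { refl → Compatible.asym K u≺v u≺v })
    ... | E , eE , inj₁ (u∈E , v∉E) =
      -- The vertex outside `E` is now the later one, so both orders are reversed.
      before-transfer (reverse K) (reverse L) (λ o → coherent-reverse (h o))
        (connected E G eE eG) v∈G v∉E u∈E u≺v
    ... | E , eE , inj₂ (v∈E , u∉E) =
      before-transfer K L h (connected E F eE eF) u∈F u∉E v∈E u≺v

    -- A separating set misses `u` or `v`, so its path to a set containing the missed vertex has a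
    -- first edge. That overlap fixes the initial orientation.
    overlap-exists : ∀ {u v} → Covered u → Covered v → u ≢ v → ∃[ A ] ∃[ B ] Overlapping A B
    overlap-exists cu@(F , eF , u∈F) cv@(G , eG , v∈G) u≢v with separated cu cv u≢v
    ... | E , eE , inj₁ (_ , v∉E) with connected E G eE eG
    ...   | ε     = ⊥-elim (v∉E v∈G)
    ...   | o ◅ _ = _ , _ , o
    overlap-exists cu@(F , eF , u∈F) cv@(G , eG , v∈G) u≢v | E , eE , inj₂ (_ , u∉E)
      with connected E F eE eF
    ...   | ε     = ⊥-elim (u∉E u∈F)
    ...   | o ◅ _ = _ , _ , o

    -- A single overlap decides whether `⊏` is kept or reversed; coherence there spreads to all
    -- overlaps.
    order-unique-up-to-reversal : ∀ {_≺_ _⊏_} → Compatible _≺_ → Compatible _⊏_ →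
      ∀ {x y} → Covered x → Covered y → x ≢ y →
      (∀ {u v} → Covered u → Covered v → u ≺ v → u ⊏ v) ⊎
      (∀ {u v} → Covered u → Covered v → u ≺ v → v ⊏ u)
    order-unique-up-to-reversal K L cx cy x≢y with overlap-exists cx cy x≢y
    ... | _ , _ , o with orient K o | orient L o
    ...   | inj₁ d | inj₁ e =
      inj₁ (order-agrees K L (coherent-everywhere K L o (inj₁ (d , e))))
    ...   | inj₂ d | inj₂ e =
      inj₁ (order-agrees K L (coherent-everywhere K L o (inj₂ (d , e))))
    ...   | inj₁ d | inj₂ e = inj₂ (order-agrees K (reverse L)
      (coherent-everywhere K (reverse L) o (inj₁ (d , before-reverse e))))
    ...   | inj₂ d | inj₁ e = inj₂ (order-agrees K (reverse L)
      (coherent-everywhere K (reverse L) o (inj₂ (d , before-reverse e))))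

-- Circular orders cut open at a base vertex.

[m+n%d]%d≡[m+n]%d : ∀ m n d .{{_ : NonZero d}} → (m + n % d) % d ≡ (m + n) % d
[m+n%d]%d≡[m+n]%d m n d = begin
  (m + n % d) % d         ≡⟨ %-distribˡ-+ m (n % d) d ⟩
  (m % d + n % d % d) % d ≡⟨ cong (λ k → (m % d + k) % d) (m%n%n≡m%n n d) ⟩
  (m % d + n % d) % d     ≡⟨ %-distribˡ-+ m n d ⟨
  (m + n) % d             ∎
  where open ≡-Reasoning

toℕ-next : ∀ {m} (i : Fin (suc m)) → toℕ (next i) ≡ suc (toℕ i) % suc m
toℕ-next {m} i with toℕ i <? m
... | yes i<m = trans (toℕ-fromℕ< (s≤s i<m)) (sym (m<n⇒m%n≡m (s≤s i<m)))
... | no  i≮m = sym (trans (cong (λ k → suc k % suc m) (≤-antisym (toℕ≤pred[n] i) (≮⇒≥ i≮m)))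
                           (n%n≡0 (suc m)))

iterate-+ : ∀ {A : Set} (f : A → A) i j (x : A) → iterate f (i + j) x ≡ iterate f i (iterate f j x)
iterate-+ f zero    j x = refl
iterate-+ f (suc i) j x = cong f (iterate-+ f i j x)

module FromBase {m : ℕ} (π : CircularOrdering (suc m)) (x : Fin (suc m)) where

  private
    n = suc m
    s = succV π

  position : Fin n → ℕ
  position v = toℕ (π ⟨$⟩ʳ v)

  position-injective : ∀ {u v} → position u ≡ position v → u ≡ v
  position-injective eq = Injection.injective (↔⇒↣ π) (toℕ-injective eq)

  position-% : ∀ v → position v % n ≡ position v
  position-% v = m<n⇒m%n≡m (toℕ<n (π ⟨$⟩ʳ v))

  position-iterate : ∀ k v → position (iterate s k v) ≡ (k + position v) % n
  position-iterate zero    v = sym (position-% v)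
  position-iterate (suc k) v = begin
    position (s w)                   ≡⟨ cong toℕ (inverseʳ π) ⟩
    toℕ (next (π ⟨$⟩ʳ w))            ≡⟨ toℕ-next (π ⟨$⟩ʳ w) ⟩
    suc (position w) % n             ≡⟨ cong (λ k → suc k % n) (position-iterate k v) ⟩
    (1 + (k + position v) % n) % n   ≡⟨ [m+n%d]%d≡[m+n]%d 1 (k + position v) n ⟩
    (suc k + position v) % n         ∎
    where
    open ≡-Reasoning
    w = iterate s k v

  iterate-n : ∀ v → iterate s n v ≡ v
  iterate-n v = position-injective (begin
    position (iterate s n v)  ≡⟨ position-iterate n v ⟩
    (n + position v) % n      ≡⟨ cong (_% n) (+-comm n (position v)) ⟩
    (position v + n) % n      ≡⟨ [m+n]%n≡m%n (position v) n ⟩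
    position v % n            ≡⟨ position-% v ⟩
    position v                ∎)
    where open ≡-Reasoning

  -- Represents minus `position x` modulo `n`, so that `distance` below counts successor steps from
  -- `x` without truncated subtraction.
  offset : ℕ
  offset = n ∸ position x

  offset+position : offset + position x ≡ n
  offset+position = m∸n+n≡m (<⇒≤ (toℕ<n (π ⟨$⟩ʳ x)))

  distance : Fin n → ℕ
  distance v = (position v + offset) % n

  distance<n : ∀ v → distance v < n
  distance<n v = m%n<n (position v + offset) n

  iterate-distance : ∀ v → iterate s (distance v) x ≡ v
  iterate-distance v = position-injective (begin
    position (iterate s (distance v) x)                ≡⟨ position-iterate (distance v) x ⟩
    ((position v + offset) % n + position x) % n       ≡⟨ cong (_% n) (+-comm (distance v) (position x)) ⟩
    (position x + (position v + offset) % n) % n       ≡⟨ [m+n%d]%d≡[m+n]%d (position x) (position v + offset) n ⟩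
    (position x + (position v + offset)) % n           ≡⟨ cong (_% n) (+-comm (position x) (position v + offset)) ⟩
    (position v + offset + position x) % n             ≡⟨ cong (_% n) (+-assoc (position v) offset (position x)) ⟩
    (position v + (offset + position x)) % n           ≡⟨ cong (λ k → (position v + k) % n) offset+position ⟩
    (position v + n) % n                               ≡⟨ [m+n]%n≡m%n (position v) n ⟩
    position v % n                                     ≡⟨ position-% v ⟩
    position v                                         ∎)
    where open ≡-Reasoning

  distance-iterate : ∀ {k} → k < n → distance (iterate s k x) ≡ k
  distance-iterate {k} k<n = begin
    (position (iterate s k x) + offset) % n   ≡⟨ cong (λ p → (p + offset) % n) (position-iterate k x) ⟩
    ((k + position x) % n + offset) % n       ≡⟨ cong (_% n) (+-comm ((k + position x) % n) offset) ⟩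
    (offset + (k + position x) % n) % n       ≡⟨ [m+n%d]%d≡[m+n]%d offset (k + position x) n ⟩
    (offset + (k + position x)) % n           ≡⟨ cong (_% n) (+-comm offset (k + position x)) ⟩
    (k + position x + offset) % n             ≡⟨ cong (_% n) (+-assoc k (position x) offset) ⟩
    (k + (position x + offset)) % n           ≡⟨ cong (λ p → (k + p) % n) (+-comm (position x) offset) ⟩
    (k + (offset + position x)) % n           ≡⟨ cong (λ p → (k + p) % n) offset+position ⟩
    (k + n) % n                               ≡⟨ [m+n]%n≡m%n k n ⟩
    k % n                                     ≡⟨ m<n⇒m%n≡m k<n ⟩
    k                                         ∎
    where open ≡-Reasoning

  distance-injective : ∀ {u v} → distance u ≡ distance v → u ≡ v
  distance-injective {u} {v} eq =
    trans (sym (iterate-distance u)) (trans (cong (λ k → iterate s k x) eq) (iterate-distance v))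

  distance-positive : ∀ {v} → v ≢ x → 0 < distance v
  distance-positive {v} v≢x = n≢0⇒n>0 λ d≡0 →
    v≢x (distance-injective (trans d≡0 (sym (distance-iterate z<s))))

  iterate≢base : ∀ {k} → 0 < k → k < n → iterate s k x ≢ x
  iterate≢base 0<k k<n eq = <⇒≢ 0<k
    (trans (sym (distance-iterate z<s)) (trans (cong distance (sym eq)) (distance-iterate k<n)))

  distance-isStrictTotalOrder : IsStrictTotalOrder _≡_ (_<_ on distance)
  distance-isStrictTotalOrder = record
    { isStrictPartialOrder = record
      { isEquivalence = isEquivalence
      ; irrefl = λ u≡v → <-irrefl (cong distance u≡v)
      ; trans = <-trans
      ; <-resp-≈ = (λ { refl p → p }) , (λ { refl p → p })
      }
    ; compare = compare
    }
    where
    compare : ∀ u v → _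
    compare u v with <-cmp (distance u) (distance v)
    ... | tri< a ¬b ¬c = tri< a (¬b ∘ cong distance) ¬c
    ... | tri≈ ¬a b ¬c = tri≈ ¬a (distance-injective b) ¬c
    ... | tri> ¬a ¬b c = tri> ¬a (¬b ∘ cong distance) c

  -- The arc of length k starting at distance j from the base; the second summand is the
  -- part that has wrapped around past the base.
  InArc : ℕ → ℕ → ℕ → Set
  InArc j k d = (j ≤ d × d < j + k) ⊎ (d + n < j + k)

  -- The bound `i + j < n + n` allows at most one passage through the base, which is the second
  -- summand of `InArc`.
  inArc-intro : ∀ {j k i} → i < k → i + j < n + n → InArc j k (distance (iterate s (i + j) x))
  inArc-intro {j} {k} {i} i<k i+j<2n with i + j <? n
  ... | yes i+j<n = inj₁ (subst (j ≤_) (sym eq) (m≤n+m j i) ,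
                          subst₂ _<_ (sym eq) (+-comm k j) (+-monoˡ-< j i<k))
    where
    eq : distance (iterate s (i + j) x) ≡ i + j
    eq = distance-iterate i+j<n
  ... | no i+j≮n = inj₂ (subst₂ _<_ (sym (trans (cong (_+ n) eq) split)) (+-comm k j) (+-monoˡ-< j i<k))
    where
    l = i + j ∸ n
    split : l + n ≡ i + j
    split = m∸n+n≡m (≮⇒≥ i+j≮n)
    l<n : l < n
    l<n = +-cancelʳ-< n l n (subst (_< n + n) (sym split) i+j<2n)
    eq : distance (iterate s (i + j) x) ≡ l
    eq = begin
      distance (iterate s (i + j) x)              ≡⟨ cong (λ k → distance (iterate s k x)) split ⟨
      distance (iterate s (l + n) x)              ≡⟨ cong distance (iterate-+ s l n x) ⟩
      distance (iterate s l (iterate s n x))      ≡⟨ cong (distance ∘ iterate s l) (iterate-n x) ⟩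
      distance (iterate s l x)                    ≡⟨ distance-iterate l<n ⟩
      l                                           ∎
      where open ≡-Reasoning

  inArc-elim : ∀ {j k u} → j < n → InArc j k (distance u) → ∃[ i ] (i < k × u ≡ iterate s (i + j) x)
  inArc-elim {j} {k} {u} _ (inj₁ (j≤d , d<j+k)) = distance u ∸ j ,
    +-cancelʳ-< j (distance u ∸ j) k (subst₂ _<_ (sym (m∸n+n≡m j≤d)) (+-comm j k) d<j+k) ,
    trans (sym (iterate-distance u)) (cong (λ k → iterate s k x) (sym (m∸n+n≡m j≤d)))
  inArc-elim {j} {k} {u} j<n (inj₂ d+n<j+k) = distance u + n ∸ j ,
    +-cancelʳ-< j (distance u + n ∸ j) k (subst₂ _<_ (sym eq) (+-comm j k) d+n<j+k) ,
    (begin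
      u                                            ≡⟨ iterate-distance u ⟨
      iterate s (distance u) x                     ≡⟨ cong (iterate s (distance u)) (iterate-n x) ⟨
      iterate s (distance u) (iterate s n x)       ≡⟨ iterate-+ s (distance u) n x ⟨
      iterate s (distance u + n) x                 ≡⟨ cong (λ k → iterate s k x) eq ⟨
      iterate s (distance u + n ∸ j + j) x         ∎)
    where
    open ≡-Reasoning
    eq : distance u + n ∸ j + j ≡ distance u + n
    eq = m∸n+n≡m (≤-trans (<⇒≤ j<n) (m≤n+m n (distance u)))

  arc⇒inArc : ∀ {A} → IsArc π A →
    (∀ u → u ∉ A) ⊎ ∃[ j ] ∃[ k ] (∀ u → (u ∈ A) ⇔ InArc j k (distance u))
  arc⇒inArc (inj₁ empty) = inj₁ empty
  arc⇒inArc {A} (inj₂ (v , k , k≤n , char)) = inj₂ (j , k , λ u → mk⇔ (to u) (from u))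
    where
    j = distance v
    iterate-v : ∀ i → iterate s i v ≡ iterate s (i + j) x
    iterate-v i = trans (cong (iterate s i) (sym (iterate-distance v))) (sym (iterate-+ s i j x))
    to : ∀ u → u ∈ A → InArc j k (distance u)
    to u u∈A with Equivalence.to (char u) u∈A
    -- The bounds `i < k ≤ n` and `distance v < n` rule out a second wrap.
    ... | i , i<k , refl = subst (InArc j k ∘ distance) (sym (iterate-v i))
      (inArc-intro i<k (+-mono-< (<-≤-trans i<k k≤n) (distance<n v)))
    from : ∀ u → InArc j k (distance u) → u ∈ A
    from u h with inArc-elim {j} {k} {u} (distance<n v) h
    ... | i , i<k , eq = Equivalence.from (char u) (i , i<k , trans eq (sym (iterate-v i)))

  -- A wrapped part always includes distance 0. An arc avoiding the base therefore has only the
  -- interval summand.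
  inArc-convex : ∀ {j k a b c} → ¬ InArc j k 0 → InArc j k a → InArc j k c →
                 a < b → b < c → InArc j k b
  inArc-convex x∉ (inj₁ (j≤a , _)) (inj₁ (_ , c<j+k)) a<b b<c =
    inj₁ (≤-trans j≤a (<⇒≤ a<b) , <-trans b<c c<j+k)
  inArc-convex {a = a} x∉ (inj₂ h) _ _ _ = ⊥-elim (x∉ (inj₂ (≤-<-trans (m≤n+m n a) h)))
  inArc-convex {c = c} x∉ _ (inj₂ h) _ _ = ⊥-elim (x∉ (inj₂ (≤-<-trans (m≤n+m n c) h)))

  -- An arc through the base either starts there, so that `j` is 0, or wraps and contains every
  -- distance from `j` up to `n`. A gap between `a` and `c` would catch `a` or `c` in the arc as
  -- well.
  inArc-coconvex : ∀ {j k a b c} → c < n → InArc j k 0 → ¬ InArc j k a → ¬ InArc j k c →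
                   a < b → b < c → ¬ InArc j k b
  inArc-coconvex _ _ a∉ _ a<b _ (inj₂ h) = a∉ (inj₂ (<-trans (+-monoˡ-< n a<b) h))
  inArc-coconvex _ (inj₁ (z≤n , _)) a∉ _ a<b _ (inj₁ (_ , b<k)) =
    a∉ (inj₁ (z≤n , <-trans a<b b<k))
  inArc-coconvex c<n (inj₂ n<j+k) _ c∉ _ b<c (inj₁ (j≤b , _)) =
    c∉ (inj₁ (≤-trans j≤b (<⇒≤ b<c) , <-trans c<n n<j+k))

  arc-convex : ∀ {A a b c} → IsArc π A → x ∉ A → a ∈ A → c ∈ A →
               distance a < distance b → distance b < distance c → b ∈ A
  arc-convex arc x∉A a∈A c∈A a<b b<c with arc⇒inArc arc
  ... | inj₁ empty = ⊥-elim (empty _ a∈A)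
  ... | inj₂ (j , k , char) = from (inArc-convex x∉ (to a∈A) (to c∈A) a<b b<c)
    where
    to : ∀ {u} → _
    to {u} = Equivalence.to (char u)
    from : ∀ {u} → _
    from {u} = Equivalence.from (char u)
    x∉ : ¬ InArc j k 0
    x∉ h = x∉A (from (subst (InArc j k) (sym (distance-iterate z<s)) h))

  arc-coconvex : ∀ {A a b c} → IsArc π A → x ∈ A → a ∉ A → c ∉ A →
                 distance a < distance b → distance b < distance c → b ∉ A
  arc-coconvex arc x∈A a∉A c∉A a<b b<c b∈A with arc⇒inArc arc
  ... | inj₁ empty = empty _ x∈A
  ... | inj₂ (j , k , char) =
    inArc-coconvex (distance<n _) (subst (InArc j k) (distance-iterate z<s) (to x∈A))
      (a∉A ∘ from) (c∉A ∘ from) a<b b<c (to b∈A)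
    where
    to : ∀ {u} → _
    to {u} = Equivalence.to (char u)
    from : ∀ {u} → _
    from {u} = Equivalence.from (char u)

-- Separating hyperedges and complementation at the base.

separating-edge : ∀ {n} {H : Hypergraph n} → TwinFree H → ∀ {u v} → u ≢ v →
  ∃[ E ] (E L.∈ H × ((u ∈ E × v ∉ E) ⊎ (v ∈ E × u ∉ E)))
separating-edge {H = H} twinFree {u} {v} u≢v
  with Any.any? (λ E → (u ∈? E ×-dec ¬? (v ∈? E)) ⊎-dec (v ∈? E ×-dec ¬? (u ∈? E))) H
... | yes any = L.find any
... | no none = ⊥-elim (twinFree u v (u≢v , λ E E∈H → mk⇔
  (λ u∈E → decidable-stable (v ∈? E) (λ v∉E → none (L.lose E∈H (inj₁ (u∈E , v∉E)))))
  (λ v∈E → decidable-stable (u ∈? E) (λ u∉E → none (L.lose E∈H (inj₂ (v∈E , u∉E)))))))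

⊈-witness : ∀ {n} {A B : Subset n} → ¬ (∀ {u} → u ∈ A → u ∈ B) → ∃[ u ] (u ∈ A × u ∉ B)
⊈-witness {A = A} {B} A⊈B with any? (λ u → u ∈? A ×-dec ¬? (u ∈? B))
... | yes w = w
... | no none = ⊥-elim (A⊈B (λ {u} u∈A →
  decidable-stable (u ∈? B) (λ u∉B → none (u , u∈A , u∉B))))

module SeparatedFrom {m : ℕ} (H : Hypergraph (suc m)) (x : Fin (suc m)) where

  private
    n = suc m

  -- `E ∋ v` says that `E` separates `v` from `x`: this is membership in `E` or in its complement,
  -- whichever avoids `x`. The index remains the original hyperedge.
  _∋_ : Subset n → Fin n → Set
  E ∋ v = (v ∈ E × x ∉ E) ⊎ (v ∉ E × x ∈ E)

  _∋?_ : ∀ E → Decidable (E ∋_)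
  E ∋? v = (v ∈? E ×-dec ¬? (x ∈? E)) ⊎-dec (¬? (v ∈? E) ×-dec x ∈? E)

  open ConvexFamily (L._∈ H) _∋_ _∋?_ public

  arcOrdering⇒compatible : ∀ π → IsArcOrdering H π → Compatible (_<_ on FromBase.distance π x)
  arcOrdering⇒compatible π arcs = record
    { isStrictTotalOrder = distance-isStrictTotalOrder ; convex = convex }
    where
    open FromBase π x
    convex : ∀ {E a b c} → E L.∈ H → E ∋ a → E ∋ c →
             distance a < distance b → distance b < distance c → E ∋ b
    convex E∈H (inj₁ (a∈E , x∉E)) (inj₁ (c∈E , _)) a<b b<c =
      inj₁ (arc-convex (arcs _ E∈H) x∉E a∈E c∈E a<b b<c , x∉E)
    convex E∈H (inj₂ (a∉E , x∈E)) (inj₂ (c∉E , _)) a<b b<c =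
      inj₂ (arc-coconvex (arcs _ E∈H) x∈E a∉E c∉E a<b b<c , x∈E)
    convex E∈H (inj₁ (_ , x∉E)) (inj₂ (_ , x∈E)) _ _ = ⊥-elim (x∉E x∈E)
    convex E∈H (inj₂ (_ , x∈E)) (inj₁ (_ , x∉E)) _ _ = ⊥-elim (x∉E x∈E)

  ∉⇒∌ : ∀ {E v} → v ∉ E → x ∉ E → ¬ E ∋ v
  ∉⇒∌ v∉E x∉E (inj₁ (v∈E , _)) = v∉E v∈E
  ∉⇒∌ v∉E x∉E (inj₂ (_ , x∈E)) = x∉E x∈E

  ∈⇒∌ : ∀ {E v} → v ∈ E → x ∈ E → ¬ E ∋ v
  ∈⇒∌ v∈E x∈E (inj₁ (_ , x∉E)) = x∉E x∈E
  ∈⇒∌ v∈E x∈E (inj₂ (v∉E , _)) = v∉E v∈E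

  -- Strict overlap means that all four regions cut out by A and B are inhabited, and this
  -- survives complementing A or B.
  strictOverlap⇒overlapping : ∀ {A B} → SOEdge H A B → Overlapping A B
  strictOverlap⇒overlapping {A} {B}
    (A∈H , B∈H , ((p , p∈A , p∈B) , A⊈B , B⊈A) , (t , t∉A , t∉B))
    with ⊈-witness A⊈B | ⊈-witness B⊈A | x ∈? A | x ∈? B
  ... | q , q∈A , q∉B | r , r∈B , r∉A | no x∉A | no x∉B = A∈H , B∈H ,
    (p , inj₁ (p∈A , x∉A) , inj₁ (p∈B , x∉B)) ,
    (q , inj₁ (q∈A , x∉A) , ∉⇒∌ q∉B x∉B) ,
    (r , inj₁ (r∈B , x∉B) , ∉⇒∌ r∉A x∉A)
  ... | q , q∈A , q∉B | r , r∈B , r∉A | yes x∈A | no x∉B = A∈H , B∈H ,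
    (r , inj₂ (r∉A , x∈A) , inj₁ (r∈B , x∉B)) ,
    (t , inj₂ (t∉A , x∈A) , ∉⇒∌ t∉B x∉B) ,
    (p , inj₁ (p∈B , x∉B) , ∈⇒∌ p∈A x∈A)
  ... | q , q∈A , q∉B | r , r∈B , r∉A | no x∉A | yes x∈B = A∈H , B∈H ,
    (q , inj₁ (q∈A , x∉A) , inj₂ (q∉B , x∈B)) ,
    (p , inj₁ (p∈A , x∉A) , ∈⇒∌ p∈B x∈B) ,
    (t , inj₂ (t∉B , x∈B) , ∉⇒∌ t∉A x∉A)
  ... | q , q∈A , q∉B | r , r∈B , r∉A | yes x∈A | yes x∈B = A∈H , B∈H ,
    (t , inj₂ (t∉A , x∈A) , inj₂ (t∉B , x∈B)) ,
    (r , inj₂ (r∉A , x∈A) , ∈⇒∌ r∈B x∈B) ,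
    (q , inj₂ (q∉B , x∈B) , ∈⇒∌ q∈A x∈A)

  ∋-connected : StrictlyOverlapConnected H → ∀ A B → A L.∈ H → B L.∈ H → Star Overlapping A B
  ∋-connected (_ , conn) A B A∈H B∈H = Star.map strictOverlap⇒overlapping (conn A B A∈H B∈H)

  -- Complementation keeps a separating set separating; it only swaps the roles of `u` and `v`.
  ∋-separated : TwinFree H → ∀ {u v} → u ≢ v →
                ∃[ E ] (E L.∈ H × ((E ∋ u × ¬ E ∋ v) ⊎ (E ∋ v × ¬ E ∋ u)))
  ∋-separated twinFree u≢v with separating-edge twinFree u≢v
  ... | E , E∈H , sep with x ∈? E | sep
  ...   | yes x∈E | inj₁ (u∈E , v∉E) = E , E∈H , inj₂ (inj₂ (v∉E , x∈E) , ∈⇒∌ u∈E x∈E)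
  ...   | yes x∈E | inj₂ (v∈E , u∉E) = E , E∈H , inj₁ (inj₂ (u∉E , x∈E) , ∈⇒∌ v∈E x∈E)
  ...   | no x∉E  | inj₁ (u∈E , v∉E) = E , E∈H , inj₁ (inj₁ (u∈E , x∉E) , ∉⇒∌ v∉E x∉E)
  ...   | no x∉E  | inj₂ (v∈E , u∉E) = E , E∈H , inj₂ (inj₁ (v∈E , x∉E) , ∉⇒∌ u∉E x∉E)

  ∋-covered : TwinFree H → ∀ {v} → v ≢ x → ∃[ E ] (E L.∈ H × E ∋ v)
  ∋-covered twinFree v≢x with separating-edge twinFree v≢x
  ... | E , E∈H , inj₁ (v∈E , x∉E) = E , E∈H , inj₁ (v∈E , x∉E)
  ... | E , E∈H , inj₂ (x∈E , v∉E) = E , E∈H , inj₂ (v∉E , x∈E)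

  distances-agree-up-to-reversal : TwinFree H → StrictlyOverlapConnected H →
    ∀ π ρ → IsArcOrdering H π → IsArcOrdering H ρ →
    let d = FromBase.distance π x; e = FromBase.distance ρ x in
    (∀ {u v} → u ≢ x → v ≢ x → d u < d v → e u < e v) ⊎
    (∀ {u v} → u ≢ x → v ≢ x → d u < d v → e v < e u)
  distances-agree-up-to-reversal twinFree conn π ρ πarcs ρarcs
    with any? (λ u → any? (λ v → ¬? (u ≟ x) ×-dec ¬? (v ≟ x) ×-dec ¬? (u ≟ v)))
  -- No two distinct vertices differ from `x`, so there is nothing to compare.
  ... | no none = inj₁ (λ {u} {v} u≢x v≢x du<dv → ⊥-elim
    (none (u , v , u≢x , v≢x , λ u≡v → <⇒≢ du<dv (cong (FromBase.distance π x) u≡v))))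
  ... | yes (u , v , u≢x , v≢x , u≢v)
    with Rigidity.order-unique-up-to-reversal (∋-connected conn) (λ _ _ → ∋-separated twinFree)
           (arcOrdering⇒compatible π πarcs) (arcOrdering⇒compatible ρ ρarcs)
           (∋-covered twinFree u≢x) (∋-covered twinFree v≢x) u≢v
  ...   | inj₁ h = inj₁ (λ u≢x v≢x → h (∋-covered twinFree u≢x) (∋-covered twinFree v≢x))
  ...   | inj₂ h = inj₂ (λ u≢x v≢x → h (∋-covered twinFree u≢x) (∋-covered twinFree v≢x))

-- Recovering the successor relation from the order of distances.

-- A bijection between the vertices other than `x` and the numbers strictly between 0 and `n`.
-- Leaving out `x` and 0 makes the notion stable under `k ↦ n ∸ k`.
record Enumeration {V : Set} (n : ℕ) (x : V) (index : V → ℕ) (point : ℕ → V) : Set where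
  field
    index>0     : ∀ {v} → v ≢ x → 0 < index v
    index<n     : ∀ {v} → v ≢ x → index v < n
    point≢x     : ∀ {k} → 0 < k → k < n → point k ≢ x
    index-point : ∀ {k} → 0 < k → k < n → index (point k) ≡ k
    point-index : ∀ {v} → v ≢ x → point (index v) ≡ v

module _ {V : Set} {n : ℕ} {x : V} where

  reverse-enumeration : ∀ {i p} → Enumeration n x i p →
                        Enumeration n x (λ v → n ∸ i v) (λ k → p (n ∸ k))
  reverse-enumeration {i} {p} E = record
    { index>0     = λ v≢x → m<n⇒0<n∸m (index<n v≢x)
    ; index<n     = λ v≢x → ∸-monoʳ-< (index>0 v≢x) (<⇒≤ (index<n v≢x))
    ; point≢x     = λ 0<k k<n → point≢x (m<n⇒0<n∸m k<n) (∸-monoʳ-< 0<k (<⇒≤ k<n))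
    ; index-point = λ 0<k k<n → trans
        (cong (n ∸_) (index-point (m<n⇒0<n∸m k<n) (∸-monoʳ-< 0<k (<⇒≤ k<n))))
        (m∸[m∸n]≡n (<⇒≤ k<n))
    ; point-index = λ v≢x → trans (cong p (m∸[m∸n]≡n (<⇒≤ (index<n v≢x)))) (point-index v≢x)
    }
    where open Enumeration E

  Monotone : (i j : V → ℕ) → Set
  Monotone i j = ∀ {u v} → u ≢ x → v ≢ x → i u < i v → j u < j v

  monotone-inverse : ∀ {i p j q} → Enumeration n x i p → Enumeration n x j q →
                     Monotone i j → Monotone j i
  monotone-inverse {i} {p} {j} E F mono {u} {v} u≢x v≢x ju<jv with <-cmp (i u) (i v)
  ... | tri< iu<iv _ _ = iu<iv
  ... | tri≈ _ iu≡iv _ = ⊥-elim (<⇒≢ ju<jv (cong j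
    (trans (sym (point-index u≢x)) (trans (cong p iu≡iv) (point-index v≢x)))))
    where open Enumeration E
  ... | tri> _ _ iv<iu = ⊥-elim (<-asym ju<jv (mono v≢x u≢x iv<iu))

  -- The values `j (p 1)`, `j (p 2)`, and so on form a strictly increasing sequence starting at 1 or
  -- more.
  monotone⇒expanding : ∀ {i p j q} → Enumeration n x i p → Enumeration n x j q → Monotone i j →
                       ∀ {k} → 0 < k → k < n → k ≤ j (p k)
  monotone⇒expanding E F mono {suc zero} _ k<n =
    Enumeration.index>0 F (Enumeration.point≢x E z<s k<n)
  monotone⇒expanding E F mono {suc k@(suc _)} _ k+1<n =
    ≤-<-trans (monotone⇒expanding E F mono z<s k<n)
      (mono (point≢x z<s k<n) (point≢x z<s k+1<n)
        (subst₂ _<_ (sym (index-point z<s k<n)) (sym (index-point z<s k+1<n)) (n<1+n k)))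
    where
    open Enumeration E
    k<n : k < n
    k<n = <-trans (n<1+n k) k+1<n

  monotone⇒≗ : ∀ {i p j q} → Enumeration n x i p → Enumeration n x j q → Monotone i j →
               ∀ {k} → 0 < k → k < n → p k ≡ q k
  monotone⇒≗ {i} {p} {j} {q} E F mono {k} 0<k k<n = begin
    p k         ≡⟨ F.point-index pk≢x ⟨
    q (j (p k)) ≡⟨ cong q (≤-antisym jpk≤k (monotone⇒expanding E F mono 0<k k<n)) ⟩
    q k         ∎
    where
    open ≡-Reasoning
    module E = Enumeration E
    module F = Enumeration F
    pk≢x : p k ≢ x
    pk≢x = E.point≢x 0<k k<n
    jpk≤k : j (p k) ≤ k
    -- The expanding bound for the inverse map is taken at index `j (p k)`, where `q` returns `p k`.
    jpk≤k = subst (j (p k) ≤_) (trans (cong i (F.point-index pk≢x)) (E.index-point 0<k k<n))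
      (monotone⇒expanding F E (monotone-inverse E F mono) (F.index>0 pk≢x) (F.index<n pk≢x))

enumeration : ∀ {m} (π : CircularOrdering (suc m)) x →
  Enumeration (suc m) x (FromBase.distance π x) (λ k → iterate (succV π) k x)
enumeration π x = record
  { index>0     = distance-positive
  ; index<n     = λ _ → distance<n _
  ; point≢x     = iterate≢base
  ; index-point = λ _ → distance-iterate
  ; point-index = λ _ → iterate-distance _
  }
  where open FromBase π x

module _ {m : ℕ} (π ρ : CircularOrdering (suc m)) (x : Fin (suc m)) where

  private
    n = suc m
    s = succV π
    t = succV ρ
    module P = FromBase π x
    module R = FromBase ρ x

  monotone⇒sameOrdering : Monotone {n = n} {x} P.distance R.distance → SameOrdering π ρ
  monotone⇒sameOrdering mono v = begin
    s v                              ≡⟨ cong s (P.iterate-distance v) ⟨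
    iterate s (suc (P.distance v)) x ≡⟨ iterates (suc (P.distance v)) (P.distance<n v) ⟩
    iterate t (suc (P.distance v)) x ≡⟨ cong t (iterates (P.distance v) (<⇒≤ (P.distance<n v))) ⟨
    t (iterate s (P.distance v) x)   ≡⟨ cong t (P.iterate-distance v) ⟩
    t v                              ∎
    where
    open ≡-Reasoning
    -- The range includes `k = n`, where both walks return to `x`; this covers the successor of the
    -- last vertex.
    iterates : ∀ k → k ≤ n → iterate s k x ≡ iterate t k x
    iterates zero _ = refl
    iterates (suc k) k<n with m≤n⇒m<n∨m≡n k<n
    ... | inj₁ k+1<n = monotone⇒≗ (enumeration π x) (enumeration ρ x) mono z<s k+1<n
    ... | inj₂ refl  = trans (P.iterate-n x) (sym (R.iterate-n x))

  -- Complemented distances enumerate `ρ` backwards from `x`, so `k` steps of `s` reach the same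
  -- vertex as `n ∸ k` steps of `t`. One further step of each then cancels.
  antitone⇒reverseOrdering : Monotone {n = n} {x} P.distance (λ v → n ∸ R.distance v) →
                             ReverseOrdering π ρ
  antitone⇒reverseOrdering mono v = begin
    t (s v)                      ≡⟨ cong (t ∘ s) (P.iterate-distance v) ⟨
    t (iterate s (suc k) x)      ≡⟨ cong t (iterates (suc k) k<n) ⟩
    iterate t (suc (n ∸ suc k)) x ≡⟨ cong (λ l → iterate t l x) (+-∸-assoc 1 k<n) ⟨
    iterate t (n ∸ k) x          ≡⟨ iterates k (<⇒≤ k<n) ⟨
    iterate s k x                ≡⟨ P.iterate-distance v ⟩
    v                            ∎
    where
    open ≡-Reasoning
    k = P.distance v
    k<n = P.distance<n v
    iterates : ∀ k → k ≤ n → iterate s k x ≡ iterate t (n ∸ k) x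
    iterates zero _ = sym (R.iterate-n x)
    iterates (suc k) k<n with m≤n⇒m<n∨m≡n k<n
    ... | inj₁ k+1<n =
      monotone⇒≗ (enumeration π x) (reverse-enumeration (enumeration ρ x)) mono z<s k+1<n
    ... | inj₂ refl  = trans (P.iterate-n x) (cong (λ l → iterate t l x) (sym (n∸n≡0 n)))

arcOrdering-unique : ∀ {n} {H : Hypergraph n} → TwinFree H → StrictlyOverlapConnected H →
  ∀ π ρ → IsArcOrdering H π → IsArcOrdering H ρ → SameOrdering π ρ ⊎ ReverseOrdering π ρ
arcOrdering-unique {zero} _ _ _ _ _ _ = inj₁ (λ ())
arcOrdering-unique {suc m} {H} twinFree conn π ρ πarcs ρarcs
  -- Any vertex can serve as base; a nonempty vertex set always offers `Fin.zero`.
  with SeparatedFrom.distances-agree-up-to-reversal H Fin.zero twinFree conn π ρ πarcs ρarcs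
... | inj₁ mono = inj₁ (monotone⇒sameOrdering π ρ Fin.zero mono)
... | inj₂ anti = inj₂ (antitone⇒reverseOrdering π ρ Fin.zero
  (λ u≢x v≢x du<dv →
    ∸-monoʳ-< (anti u≢x v≢x du<dv) (<⇒≤ (FromBase.distance<n ρ Fin.zero _))))

theorem1p2 : (n : ℕ) (H : Hypergraph n) →
    CircularArc H → TwinFree H → StrictlyOverlapConnected H →
    ∃[ π ] (IsArcOrdering H π ×
    (∀ ρ → IsArcOrdering H ρ → SameOrdering π ρ ⊎ ReverseOrdering π ρ))
theorem1p2 n H (π , arcs) twinFree conn =
  π , arcs , λ ρ ρarcs → arcOrdering-unique twinFree conn π ρ arcs ρarcs
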